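{- Consider the following game on $[2n]$. Let $X$ be a uniformly random bit. If $X=0$, every sample is drawn from the uniform distribution on $[2n]$. If $X=1$, pair the elements as $\{1,2\},\{3,4\},\dots,\{2n-1,2n\}$ and for each pair $\{2i-1,2i\}$ pick an independent uniformly random $Y_i\in\{\pm1\}$; if $Y_i=1$ put $2i-1$ in set 1 and $2i$ in set 2, otherwise put $2i$ in set 1 and $2i-1$ in set 2. At each step $t$ the player chooses $W_t\in[2n]$; set $Z_t=1$ if $W_t$ is in set 1 and $Z_t=-1$ otherwise, and the $t$-th sample is drawn from the distribution $p$ with $(p_{2i-1},p_{2i})=\left(\frac{1+Y_iZ_t}{2n},\frac{1-Y_iZ_t}{2n}\right)$ for all $i$ (when $X=0$ the choice of $W_t$ has no effect). Let $\mathcal A$ be an algorithm that accesses the samples in a single-pass streaming fashion using $M$ bits of space and $T$ samples, choosing $W_t$ at each step, and determines $X$ with error probability at most $1/3$. Then $T\cdot M=\Omega(n)$. -}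

module Defs where

open import Data.Nat as ℕ using (ℕ; zero; suc; NonZero; _^_)
open import Data.Nat.Properties using (m*n≢0)
open import Data.Fin using (Fin; zero; suc; remQuot)
open import Data.Bool using (Bool; true; false; if_then_else_; not)
open import Data.Product using (_×_; proj₁; proj₂)
open import Data.Integer using (+_)
open import Data.Rational using (ℚ; 0ℚ; 1ℚ; _+_; _*_; _-_; -_; _/_; ½)
open import Data.Vec.Functional using (_∷_)
open import Data.Rational using () renaming (_≤_ to _ℚ≤_)
open import Relation.Binary.PropositionalEquality using (_≡_)

sumFin : (k : ℕ) → (Fin k → ℚ) → ℚ
sumFin zero    f = 0ℚ
sumFin (suc k) f = f zero + sumFin k (λ i → f (suc i))

avgCube : (n : ℕ) → ((Fin n → Bool) → ℚ) → ℚ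
avgCube zero    f = f (λ ())
avgCube (suc n) f = ½ * (avgCube n (λ y → f (true ∷ y)) + avgCube n (λ y → f (false ∷ y)))

-- The ground set [2n], 0-indexed: element i*2+j (j ∈ {0,1}) is the
-- j-th element of the i-th pair, i.e. pairs {0,1},{2,3},…,{2n-2,2n-1}
-- (the paper's {1,2},{3,4},…,{2n-1,2n} shifted by one).
Elem : ℕ → Set
Elem n = Fin (n ℕ.* 2)

pairOf : ∀ {n} → Elem n → Fin n
pairOf {n} w = proj₁ (remQuot {n} 2 w)

isFirst : ∀ {n} → Elem n → Bool
isFirst {n} w with proj₂ (remQuot {n} 2 w)
... | zero  = true
... | suc _ = false

sign : Bool → ℚ
sign true  = 1ℚ
sign false = - 1ℚ

inSet1 : ∀ {n} → (Fin n → Bool) → Elem n → Bool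
inSet1 {n} Y w = if Y (pairOf {n} w) then isFirst {n} w else not (isFirst {n} w)

Zval : ∀ {n} → (Fin n → Bool) → Elem n → ℚ
Zval Y w = sign (inSet1 Y w)

Dist : ℕ → Set
Dist n = Elem n → ℚ

uniform : (n : ℕ) → .{{NonZero n}} → Dist n
uniform n _ = _/_ (+ 1) (n ℕ.* 2) {{m*n≢0 n 2}}

planted : (n : ℕ) → .{{NonZero n}} → (Fin n → Bool) → Elem n → Dist n
planted n Y w j =
  (if isFirst {n} j then 1ℚ + s else 1ℚ - s) * uniform n j
  where s = sign (Y (pairOf {n} j)) * Zval {n} Y w

-- an environment maps the player's choice W_t to the distribution of the t-th sample
Env : ℕ → Set
Env n = Elem n → Dist n

env0 : (n : ℕ) → .{{NonZero n}} → Env n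
env0 n _ = uniform n

env1 : (n : ℕ) → .{{NonZero n}} → (Fin n → Bool) → Env n
env1 n Y = planted n Y

-- A deterministic single-pass streaming algorithm with M bits of memory:
-- memory states are Fin (2 ^ M); at step t (0-indexed) in state s it chooses
-- W_t = query t s, receives the sample x, and moves to update t s x.
-- At the end it outputs its guess for X (true = 1).
record Alg (n M : ℕ) : Set where
  field
    init   : Fin (2 ^ M)
    query  : ℕ → Fin (2 ^ M) → Elem n
    update : ℕ → Fin (2 ^ M) → Elem n → Fin (2 ^ M)
    output : Fin (2 ^ M) → Bool
open Alg public

accept : ∀ {n M} → Alg n M → Env n → (k t : ℕ) → Fin (2 ^ M) → ℚ
accept A E zero    t s = if output A s then 1ℚ else 0ℚ
accept {n} A E (suc k) t s =
  sumFin (n ℕ.* 2) (λ x → E (query A t s) x * accept A E k (suc t) (update A t s x))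

acceptProb : ∀ {n M} → Alg n M → Env n → (T : ℕ) → ℚ
acceptProb A E T = accept A E T 0 (init A)

errorProb : (n : ℕ) → .{{_ : NonZero n}} → ∀ {M} → Alg n M → (T : ℕ) → ℚ
errorProb n A T =
  ½ * acceptProb A (env0 n) T
  + ½ * (1ℚ - avgCube n (λ Y → acceptProb A (env1 n Y) T))

-- A randomized algorithm: a finite probability mixture of deterministic
-- M-bit streaming algorithms (randomness independent of the samples).
record RandAlg (n M : ℕ) : Set where
  field
    r      : ℕ
    weight : Fin r → ℚ
    alg    : Fin r → Alg n M
open RandAlg public

IsMixture : ∀ {n M} → RandAlg n M → Set
IsMixture R = (∀ k → 0ℚ ℚ≤ weight R k) × (sumFin (r R) (weight R) ≡ 1ℚ)

randErrorProb : (n : ℕ) → .{{_ : NonZero n}} → ∀ {M} → RandAlg n M → (T : ℕ) → ℚ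
randErrorProb n R T = sumFin (r R) (λ k → weight R k * errorProb n (alg R k) T)

{-# OPTIONS --safe #-}
module Submission where

-- Let V be the acceptance probability from a given state under uniform samples.  In the planted
-- world one step increases E φ(V), with φ(v) = v − v²/6, by at most (24/2n) E Σᵢ (uᵢ − 2uᵢ²): here
-- uᵢ = dᵢ Yᵢ Z, the bounded coefficient dᵢ depends on the memory state s only, and the negative
-- curvature of φ supplies −2uᵢ².  Now Σᵢ (uᵢ − 2uᵢ²) ≤ log ∏ᵢ (1 + uᵢ) ≤ M − 1 + 2⁻ᴹ ∏ᵢ (1 + uᵢ).
-- The product is nonnegative and has Y-average at most 2 for each fixed s, so replacing the actual
-- state by the sum over all 2ᴹ states costs only a constant: the gain per step is at most
-- 24 (M + 1) / 2n, although s and Y are correlated.  An advantage of 1/3 thus forces n ≤ 72 T (M + 1).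

open import Defs
open import Data.Nat as ℕ using (ℕ; zero; suc; NonZero; _^_)
import Data.Nat.Properties as ℕ
open import Data.Nat.Solver renaming (module +-*-Solver to ℕ-Solver)
open import Data.Fin using (Fin; zero; suc; combine)
open import Data.Fin.Properties using (remQuot-combine)
open import Data.Bool using (Bool; true; false; if_then_else_)
open import Data.Empty using (⊥-elim)
open import Data.Product using (_×_; _,_; proj₁; proj₂)
open import Data.Sum using (inj₁; inj₂)
import Data.Integer as ℤ
import Data.Integer.Properties as ℤ
open import Data.Vec.Functional using (_∷_)
open import Relation.Nullary.Decidable using (from-no)
open import Relation.Binary.PropositionalEquality
  using (_≡_; refl; sym; trans; cong; cong₂; subst; subst₂)

module Lemmas where

  open import Data.Integer using () renaming (+_ to pos)
  open import Data.Rational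
    using (ℚ; 0ℚ; 1ℚ; ½; _+_; _*_; _-_; -_; _/_; _≤_; _<_; positive; nonNegative)
  open import Data.Rational.Properties
  import Data.Rational.Unnormalised as ℚᵘ
  import Data.Rational.Unnormalised.Properties as ℚᵘ
  open import Data.Rational.Solver
  open +-*-Solver hiding (Env)

  -- Order arithmetic in ℚ and the embedding of ℕ.

  ≤-by-diff : ∀ {p q} d → 0ℚ ≤ d → p + d ≡ q → p ≤ q
  ≤-by-diff {p} d 0≤d p+d≡q = subst₂ _≤_ (+-identityʳ p) p+d≡q (+-monoʳ-≤ p 0≤d)

  p≤q⇒0≤q-p : ∀ {p q} → p ≤ q → 0ℚ ≤ q - p
  p≤q⇒0≤q-p {p} {q} p≤q = subst (_≤ q - p) (+-inverseʳ p) (+-monoˡ-≤ (- p) p≤q)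

  0≤+ : ∀ {p q} → 0ℚ ≤ p → 0ℚ ≤ q → 0ℚ ≤ p + q
  0≤+ = +-mono-≤

  *-monoˡ : ∀ {p q r} → 0ℚ ≤ r → p ≤ q → r * p ≤ r * q
  *-monoˡ {r = r} 0≤r = *-monoˡ-≤-nonNeg r {{nonNegative 0≤r}}

  0≤* : ∀ {p q} → 0ℚ ≤ p → 0ℚ ≤ q → 0ℚ ≤ p * q
  0≤* {p} {q} 0≤p 0≤q = subst (_≤ p * q) (*-zeroʳ p) (*-monoˡ 0≤p 0≤q)

  0<* : ∀ {p q} → 0ℚ < p → 0ℚ < q → 0ℚ < p * q
  0<* {p} {q} 0<p 0<q = positive⁻¹ (p * q) {{pos*pos⇒pos p {{positive 0<p}} q {{positive 0<q}}}}

  0≤p² : ∀ p → 0ℚ ≤ p * p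
  0≤p² p with ≤-total 0ℚ p
  ... | inj₁ 0≤p = 0≤* 0≤p 0≤p
  ... | inj₂ p≤0 = subst (0ℚ ≤_) (solve 1 (λ x → (:- x) :* (:- x) := x :* x) refl p)
                     (0≤* (neg-antimono-≤ p≤0) (neg-antimono-≤ p≤0))

  1≤* : ∀ {p q} → 1ℚ ≤ p → 1ℚ ≤ q → 1ℚ ≤ p * q
  1≤* {p} {q} 1≤p 1≤q = ≤-by-diff (((p - 1ℚ) * (q - 1ℚ) + (p - 1ℚ)) + (q - 1ℚ))
    (0≤+ (0≤+ (0≤* (p≤q⇒0≤q-p 1≤p) (p≤q⇒0≤q-p 1≤q)) (p≤q⇒0≤q-p 1≤p)) (p≤q⇒0≤q-p 1≤q))
    (solve 2 (λ p q →
        con 1ℚ :+ (((p :- con 1ℚ) :* (q :- con 1ℚ) :+ (p :- con 1ℚ)) :+ (q :- con 1ℚ)) := p :* q)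
      refl p q)

  0≤1 : 0ℚ ≤ 1ℚ
  0≤1 = nonNegative⁻¹ 1ℚ

  0≤½ : 0ℚ ≤ ½
  0≤½ = nonNegative⁻¹ ½

  -- Defined by recursion so that `ι (suc k)` unfolds to a sum the ring solver can use; `ι≡/1` links
  -- it to fractions.
  ι : ℕ → ℚ
  ι zero    = 0ℚ
  ι (suc k) = 1ℚ + ι k

  0≤ι : ∀ k → 0ℚ ≤ ι k
  0≤ι zero    = ≤-refl
  0≤ι (suc k) = 0≤+ 0≤1 (0≤ι k)

  ι-+ : ∀ j k → ι (j ℕ.+ k) ≡ ι j + ι k
  ι-+ zero    k = sym (+-identityˡ (ι k))
  ι-+ (suc j) k = trans (cong (1ℚ +_) (ι-+ j k)) (sym (+-assoc 1ℚ (ι j) (ι k)))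

  ι-* : ∀ j k → ι (j ℕ.* k) ≡ ι j * ι k
  ι-* zero    k = sym (*-zeroˡ (ι k))
  ι-* (suc j) k = trans (ι-+ k (j ℕ.* k)) (trans (cong (ι k +_) (ι-* j k))
    (solve 2 (λ x y → y :+ x :* y := (con 1ℚ :+ x) :* y) refl (ι j) (ι k)))

  ι-cancel-≤ : ∀ j k → ι j ≤ ι k → j ℕ.≤ k
  ι-cancel-≤ zero    k       _ = ℕ.z≤n
  ι-cancel-≤ (suc j) zero    h = ⊥-elim (<-irrefl refl
    (<-≤-trans (positive⁻¹ 1ℚ) (≤-trans (≤-by-diff (ι j) (0≤ι j) refl) h)))
  ι-cancel-≤ (suc j) (suc k) h = ℕ.s≤s (ι-cancel-≤ j k
    (subst₂ _≤_ (drop1 (ι j)) (drop1 (ι k)) (+-monoʳ-≤ (- 1ℚ) h)))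
    where
    drop1 : ∀ x → - 1ℚ + (1ℚ + x) ≡ x
    drop1 = solve 1 (λ x → con (- 1ℚ) :+ (con 1ℚ :+ x) := x) refl

  -- Normalising a fraction is stuck on a variable k, so the equation is checked among unnormalised
  -- rationals.
  ι≡/1 : ∀ k → ι k ≡ pos k / 1
  ι≡/1 zero    = refl
  ι≡/1 (suc k) = trans (cong (1ℚ +_) (ι≡/1 k)) (toℚᵘ-injective (ℚᵘ.≃-trans
    (toℚᵘ-homo-+ 1ℚ (pos k / 1)) (ℚᵘ.≃-trans
    (ℚᵘ.+-congʳ ℚᵘ.1ℚᵘ (toℚᵘ-fromℚᵘ (ℚᵘ.mkℚᵘ (pos k) 0))) (ℚᵘ.≃-trans
    (ℚᵘ.*≡* (cong (λ z → (pos 1 ℤ.+ z) ℤ.* pos 1) (ℤ.*-identityʳ (pos k))))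
    (ℚᵘ.≃-sym (toℚᵘ-fromℚᵘ (ℚᵘ.mkℚᵘ (pos (suc k)) 0)))))))

  ι*recip : ∀ k .{{_ : NonZero k}} → ι k * (pos 1 / k) ≡ 1ℚ
  ι*recip k@(suc j) = trans (cong (_* (pos 1 / k)) (ι≡/1 k)) (toℚᵘ-injective (ℚᵘ.≃-trans
    (toℚᵘ-homo-* (pos k / 1) (pos 1 / k)) (ℚᵘ.≃-trans
    (ℚᵘ.*-cong (toℚᵘ-fromℚᵘ (ℚᵘ.mkℚᵘ (pos k) 0)) (toℚᵘ-fromℚᵘ (ℚᵘ.mkℚᵘ (pos 1) j)))
    (ℚᵘ.*≡* (trans (ℤ.*-identityʳ _) (trans (ℤ.*-identityʳ (pos k))
      (sym (trans (ℤ.*-identityˡ _) (cong pos (ℕ.*-identityˡ k))))))))))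

  -- Finite sums and products.

  sum-cong : ∀ k {f g : Fin k → ℚ} → (∀ i → f i ≡ g i) → sumFin k f ≡ sumFin k g
  sum-cong zero    f≡g = refl
  sum-cong (suc k) f≡g = cong₂ _+_ (f≡g zero) (sum-cong k (λ i → f≡g (suc i)))

  sum-mono : ∀ k {f g : Fin k → ℚ} → (∀ i → f i ≤ g i) → sumFin k f ≤ sumFin k g
  sum-mono zero    f≤g = ≤-refl
  sum-mono (suc k) f≤g = +-mono-≤ (f≤g zero) (sum-mono k (λ i → f≤g (suc i)))

  sum-nonneg : ∀ k {f : Fin k → ℚ} → (∀ i → 0ℚ ≤ f i) → 0ℚ ≤ sumFin k f
  sum-nonneg zero    0≤f = ≤-refl
  sum-nonneg (suc k) 0≤f = 0≤+ (0≤f zero) (sum-nonneg k (λ i → 0≤f (suc i)))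

  sum-+ : ∀ k (f g : Fin k → ℚ) → sumFin k (λ i → f i + g i) ≡ sumFin k f + sumFin k g
  sum-+ zero    f g = refl
  sum-+ (suc k) f g = trans (cong (f zero + g zero +_) (sum-+ k (λ i → f (suc i)) (λ i → g (suc i))))
    (solve 4 (λ a b c d → (a :+ b) :+ (c :+ d) := (a :+ c) :+ (b :+ d)) refl (f zero) (g zero)
      (sumFin k (λ i → f (suc i))) (sumFin k (λ i → g (suc i))))

  sum-*ˡ : ∀ k c (f : Fin k → ℚ) → sumFin k (λ i → c * f i) ≡ c * sumFin k f
  sum-*ˡ zero    c f = sym (*-zeroʳ c)
  sum-*ˡ (suc k) c f = trans (cong (c * f zero +_) (sum-*ˡ k c (λ i → f (suc i))))
    (sym (*-distribˡ-+ c (f zero) (sumFin k (λ i → f (suc i)))))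

  sum-*ʳ : ∀ k c (f : Fin k → ℚ) → sumFin k (λ i → f i * c) ≡ sumFin k f * c
  sum-*ʳ k c f = trans (sum-cong k (λ i → *-comm (f i) c)) (trans (sum-*ˡ k c f) (*-comm c _))

  sum-const : ∀ k c → sumFin k (λ _ → c) ≡ ι k * c
  sum-const zero    c = sym (*-zeroˡ c)
  sum-const (suc k) c = trans (cong (c +_) (sum-const k c))
    (solve 2 (λ x c → c :+ x :* c := (con 1ℚ :+ x) :* c) refl (ι k) c)

  term≤sum : ∀ k {f : Fin k → ℚ} → (∀ i → 0ℚ ≤ f i) → ∀ i → f i ≤ sumFin k f
  term≤sum (suc k) {f} 0≤f zero    = ≤-by-diff _ (sum-nonneg k (λ i → 0≤f (suc i))) refl
  term≤sum (suc k) {f} 0≤f (suc i) = ≤-trans (term≤sum k (λ i → 0≤f (suc i)) i)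
    (≤-by-diff (f zero) (0≤f zero) (+-comm _ (f zero)))

  sum-pairs : ∀ n (f : Elem n → ℚ) →
    sumFin (n ℕ.* 2) f ≡ sumFin n (λ i → f (combine i zero) + f (combine i (suc zero)))
  sum-pairs zero    f = refl
  sum-pairs (suc n) f = trans (sym (+-assoc (f zero) (f (suc zero)) _))
    (cong (f zero + f (suc zero) +_) (sum-pairs n (λ x → f (suc (suc x)))))

  prodFin : ∀ k → (Fin k → ℚ) → ℚ
  prodFin zero    f = 1ℚ
  prodFin (suc k) f = f zero * prodFin k (λ i → f (suc i))

  prod-cong : ∀ k {f g : Fin k → ℚ} → (∀ i → f i ≡ g i) → prodFin k f ≡ prodFin k g
  prod-cong zero    f≡g = refl
  prod-cong (suc k) f≡g = cong₂ _*_ (f≡g zero) (prod-cong k (λ i → f≡g (suc i)))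

  prod-nonneg : ∀ k {f : Fin k → ℚ} → (∀ i → 0ℚ ≤ f i) → 0ℚ ≤ prodFin k f
  prod-nonneg zero    0≤f = 0≤1
  prod-nonneg (suc k) 0≤f = 0≤* (0≤f zero) (prod-nonneg k (λ i → 0≤f (suc i)))

  -- Averages over the cube of sign vectors.

  avg-cong : ∀ n {f g : (Fin n → Bool) → ℚ} → (∀ Y → f Y ≡ g Y) → avgCube n f ≡ avgCube n g
  avg-cong zero    f≡g = f≡g _
  avg-cong (suc n) f≡g = cong (½ *_) (cong₂ _+_ (avg-cong n (λ Y → f≡g _)) (avg-cong n (λ Y → f≡g _)))

  avg-mono : ∀ n {f g : (Fin n → Bool) → ℚ} → (∀ Y → f Y ≤ g Y) → avgCube n f ≤ avgCube n g
  avg-mono zero    f≤g = f≤g _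
  avg-mono (suc n) f≤g = *-monoˡ 0≤½ (+-mono-≤ (avg-mono n (λ Y → f≤g _)) (avg-mono n (λ Y → f≤g _)))

  avg-+ : ∀ n (f g : (Fin n → Bool) → ℚ) → avgCube n (λ Y → f Y + g Y) ≡ avgCube n f + avgCube n g
  avg-+ zero    f g = refl
  avg-+ (suc n) f g = trans (cong (½ *_) (cong₂ _+_ (avg-+ n _ _) (avg-+ n _ _)))
    (solve 4 (λ a b c d → con ½ :* ((a :+ b) :+ (c :+ d)) := con ½ :* (a :+ c) :+ con ½ :* (b :+ d))
      refl (avgCube n (λ Y → f (true ∷ Y))) (avgCube n (λ Y → g (true ∷ Y))) _ _)

  avg-*ˡ : ∀ n c (f : (Fin n → Bool) → ℚ) → avgCube n (λ Y → c * f Y) ≡ c * avgCube n f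
  avg-*ˡ zero    c f = refl
  avg-*ˡ (suc n) c f = trans (cong (½ *_) (cong₂ _+_ (avg-*ˡ n c _) (avg-*ˡ n c _)))
    (solve 3 (λ c a b → con ½ :* (c :* a :+ c :* b) := c :* (con ½ :* (a :+ b)))
      refl c (avgCube n (λ Y → f (true ∷ Y))) _)

  avg-const : ∀ n c → avgCube n (λ _ → c) ≡ c
  avg-const zero    c = refl
  avg-const (suc n) c = trans (cong (½ *_) (cong₂ _+_ (avg-const n c) (avg-const n c)))
    (solve 1 (λ c → con ½ :* (c :+ c) := c) refl c)

  avg-sum : ∀ n k (f : Fin k → (Fin n → Bool) → ℚ) →
    avgCube n (λ Y → sumFin k (λ s → f s Y)) ≡ sumFin k (λ s → avgCube n (f s))
  avg-sum n zero    f = avg-const n 0ℚ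
  avg-sum n (suc k) f = trans (avg-+ n (f zero) _) (cong (avgCube n (f zero) +_) (avg-sum n k (λ s → f (suc s))))

  -- The coordinates of Y are independent and each factor has mean 1: its linear term cancels
  -- between the two signs.
  avg-prod≡1 : ∀ n (d : Fin n → ℚ) → avgCube n (λ Y → prodFin n (λ i → 1ℚ + d i * sign (Y i))) ≡ 1ℚ
  avg-prod≡1 zero    d = refl
  avg-prod≡1 (suc n) d = trans
    (cong (½ *_) (cong₂ _+_ (half 1ℚ) (half (- 1ℚ))))
    (solve 1 (λ d → con ½ :* ((con 1ℚ :+ d :* con 1ℚ) :+ (con 1ℚ :+ d :* con (- 1ℚ))) := con 1ℚ) refl (d zero))
    where
    half : ∀ s → avgCube n (λ Y → (1ℚ + d zero * s) * prodFin n (λ i → 1ℚ + d (suc i) * sign (Y i)))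
               ≡ 1ℚ + d zero * s
    half s = trans (avg-*ˡ n (1ℚ + d zero * s) _)
      (trans (cong ((1ℚ + d zero * s) *_) (avg-prod≡1 n (λ i → d (suc i)))) (*-identityʳ _))

  -- Bernoulli's inequality and lower bounds for products.

  pow : ℚ → ℕ → ℚ
  pow x zero    = 1ℚ
  pow x (suc m) = x * pow x m

  pow-pos : ∀ {x} m → 0ℚ < x → 0ℚ < pow x m
  pow-pos zero    0<x = positive⁻¹ 1ℚ
  pow-pos (suc m) 0<x = 0<* 0<x (pow-pos m 0<x)

  pow-one : ∀ m → pow 1ℚ m ≡ 1ℚ
  pow-one zero    = refl
  pow-one (suc m) = trans (*-identityˡ _) (pow-one m)

  -- This is (y/x)^(m+1) ≥ 1 + (m+1)(y/x - 1) with denominators cleared. In the induction the defect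
  -- is a nonnegative multiple of (x - y)².
  bernoulli : ∀ m {x y} → 0ℚ < x → 0ℚ < y →
    pow x m * (ι (suc m) * y - ι m * x) ≤ pow y (suc m)
  bernoulli zero    {x} {y} 0<x 0<y = ≤-reflexive
    (solve 2 (λ x y → con 1ℚ :* ((con 1ℚ :+ con 0ℚ) :* y :- con 0ℚ :* x) := y :* con 1ℚ) refl x y)
  bernoulli (suc m) {x} {y} 0<x 0<y = ≤-trans
    (≤-by-diff (P * (ι (suc m) * ((x - y) * (x - y))))
      (0≤* (<⇒≤ (pow-pos m 0<x)) (0≤* (0≤ι (suc m)) (0≤p² (x - y))))
      (solve 4 (λ x y P k →
          (x :* P) :* ((con 1ℚ :+ (con 1ℚ :+ k)) :* y :- (con 1ℚ :+ k) :* x)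
            :+ P :* ((con 1ℚ :+ k) :* ((x :- y) :* (x :- y)))
          := y :* (P :* ((con 1ℚ :+ k) :* y :- k :* x)))
        refl x y P (ι m)))
    (*-monoˡ (<⇒≤ 0<y) (bernoulli m 0<x 0<y))
    where P = pow x m

  -- Invariant of a product G = ∏ gᵢ with gᵢ ≥ 1/pᵢ: by AM-GM, G ≥ 1/xᵐ, where x is the mean of the m positive
  -- numbers pᵢ and σ their sum.  Together with Bernoulli this replaces log ∏ gᵢ ≥ Σ (1 − pᵢ).
  record Dominates (m : ℕ) (σ G : ℚ) : Set where
    constructor dominated
    field
      mean         : ℚ
      0<mean       : 0ℚ < mean
      m*mean≡σ     : ι m * mean ≡ σ
      0≤G          : 0ℚ ≤ G
      1≤mean^m*G   : 1ℚ ≤ pow mean m * G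

  dominates-empty : Dominates 0 0ℚ 1ℚ
  dominates-empty = dominated 1ℚ (positive⁻¹ 1ℚ) refl 0≤1 ≤-refl

  -- If y is the mean of p and m copies of x, then (m+1)y - mx = p, so Bernoulli reads xᵐ p ≤ yᵐ⁺¹.
  -- Multiplying the invariant by 1 ≤ p g finishes.
  dominates-step : ∀ {m σ G p g} → 0ℚ < p → 0ℚ ≤ g → 1ℚ ≤ p * g →
    Dominates m σ G → Dominates (suc m) (p + σ) (g * G)
  dominates-step {m} {σ} {G} {p} {g} 0<p 0≤g 1≤pg (dominated x 0<x mx≡σ 0≤G 1≤xᵐG) =
    dominated y 0<y my≡ (0≤* 0≤g 0≤G) (≤-trans (1≤* 1≤xᵐG 1≤pg)
    (subst (_≤ pow y (suc m) * (g * G))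
      (solve 4 (λ P p g G → (g :* G) :* (P :* p) := (P :* G) :* (p :* g)) refl (pow x m) p g G)
      (subst ((g * G) * (pow x m * p) ≤_) (*-comm (g * G) _)
        (*-monoˡ (0≤* 0≤g 0≤G)
          (subst (λ q → pow x m * q ≤ pow y (suc m)) p≡ (bernoulli m 0<x 0<y))))))
    where
    recip = pos 1 / suc m
    y = (p + σ) * recip
    0≤σ : 0ℚ ≤ σ
    0≤σ = subst (0ℚ ≤_) mx≡σ (0≤* (0≤ι m) (<⇒≤ 0<x))
    0<y : 0ℚ < y
    0<y = 0<* (+-mono-<-≤ 0<p 0≤σ) (positive⁻¹ recip {{normalize-pos 1 (suc m)}})
    my≡ : ι (suc m) * y ≡ p + σ
    my≡ = trans (solve 3 (λ k s r → k :* (s :* r) := s :* (k :* r)) refl (ι (suc m)) (p + σ) recip)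
      (trans (cong ((p + σ) *_) (ι*recip (suc m))) (*-identityʳ _))
    p≡ : ι (suc m) * y - ι m * x ≡ p
    p≡ = trans (cong₂ _-_ my≡ mx≡σ) (solve 2 (λ p s → (p :+ s) :- s := p) refl p σ)

  -- Bernoulli at y = 1 gives xᵐ (m + 1 - mx) ≤ 1 ≤ xᵐ G, and xᵐ cancels.
  dominates⇒≤ : ∀ {m σ G} → Dominates m σ G → ι (suc m) - σ ≤ G
  dominates⇒≤ {m} {σ} {G} (dominated x 0<x mx≡σ _ 1≤xᵐG) =
    *-cancelˡ-≤-pos (pow x m) {{positive (pow-pos m 0<x)}}
      (≤-trans (subst (λ s → pow x m * s ≤ 1ℚ)
          (cong₂ _-_ (*-identityʳ (ι (suc m))) mx≡σ)
          (subst (pow x m * (ι (suc m) * 1ℚ - ι m * x) ≤_) (pow-one (suc m))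
            (bernoulli m {y = 1ℚ} 0<x (positive⁻¹ 1ℚ))))
        1≤xᵐG)

  -- Lower bound for log (1 + u) when u ≥ −½.
  quad : ℚ → ℚ
  quad u = u - (u * u + u * u)

  -- The factor 1 + u is paired with p = 1 - `quad u`. Since (1 - u + 2u²)(1 + u) = 1 + u²(1 + 2u),
  -- the condition 1 ≤ p g is exactly where u ≥ -½ enters.
  dominates-prod : ∀ n {m σ G} (u : Fin n → ℚ) → (∀ i → - ½ ≤ u i) → Dominates m σ G →
    Dominates (n ℕ.+ m) ((ι n - sumFin n (λ i → quad (u i))) + σ) (prodFin n (λ i → 1ℚ + u i) * G)
  dominates-prod zero {m} {σ} {G} u -½≤u dom =
    subst₂ (Dominates m) (sym (+-identityˡ σ)) (sym (*-identityˡ G)) dom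
  dominates-prod (suc n) {m} {σ} {G} u -½≤u dom =
    subst₂ (Dominates (suc (n ℕ.+ m)))
      (solve 4 (λ q k s t → (con 1ℚ :- q) :+ ((k :- s) :+ t) := ((con 1ℚ :+ k) :- (q :+ s)) :+ t)
        refl (quad u₀) (ι n) (sumFin n (λ i → quad (u (suc i)))) σ)
      (sym (*-assoc (1ℚ + u₀) (prodFin n (λ i → 1ℚ + u (suc i))) G))
      (dominates-step 0<1-quad (≤-trans 0≤½ (+-monoʳ-≤ 1ℚ (-½≤u zero))) 1≤pg
        (dominates-prod n (λ i → u (suc i)) (λ i → -½≤u (suc i)) dom))
    where
    u₀ = u zero
    0<1-quad : 0ℚ < 1ℚ - quad u₀
    -- Completing the square: 1 - u + 2u² = 7/8 + 2(u - 1/4)².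
    0<1-quad = <-≤-trans (positive⁻¹ (pos 7 / 8))
      (≤-by-diff ((u₀ - pos 1 / 4) * (u₀ - pos 1 / 4) + (u₀ - pos 1 / 4) * (u₀ - pos 1 / 4))
        (0≤+ (0≤p² (u₀ - pos 1 / 4)) (0≤p² (u₀ - pos 1 / 4)))
        (solve 1 (λ u → con (pos 7 / 8) :+ ((u :- con (pos 1 / 4)) :* (u :- con (pos 1 / 4))
                                         :+ (u :- con (pos 1 / 4)) :* (u :- con (pos 1 / 4)))
                      := con 1ℚ :- (u :- (u :* u :+ u :* u))) refl u₀))
    1≤pg : 1ℚ ≤ (1ℚ - quad u₀) * (1ℚ + u₀)
    1≤pg = ≤-by-diff ((u₀ * u₀) * ((u₀ - - ½) + (u₀ - - ½)))
      (0≤* (0≤p² u₀) (0≤+ (p≤q⇒0≤q-p (-½≤u zero)) (p≤q⇒0≤q-p (-½≤u zero))))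
      (solve 1 (λ u → con 1ℚ :+ (u :* u) :* ((u :- con (- ½)) :+ (u :- con (- ½)))
                    := (con 1ℚ :- (u :- (u :* u :+ u :* u))) :* (con 1ℚ :+ u)) refl u₀)

  -- 2⁻ᴹ, written as the product that `dominates-prod` produces from M factors 1 + (-½).
  halves : ℕ → ℚ
  halves M = prodFin M (λ _ → ½)

  halves-nonneg : ∀ M → 0ℚ ≤ halves M
  halves-nonneg M = prod-nonneg M (λ _ → 0≤½)

  ι2^*halves : ∀ M → ι (2 ^ M) * halves M ≡ 1ℚ
  ι2^*halves zero    = refl
  ι2^*halves (suc M) = trans (cong (_* (½ * halves M)) (ι-* 2 (2 ^ M)))
    (trans (solve 2 (λ x h → (con (ι 2) :* x) :* (con ½ :* h) := x :* h) refl (ι (2 ^ M)) (halves M))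
      (ι2^*halves M))

  -- The tangent of log at 2ᴹ, applied to ∏ (1 + uᵢ).
  log-bound : ∀ n M (u : Fin n → ℚ) → (∀ i → - ½ ≤ u i) →
    sumFin n (λ i → quad (u i)) ≤ (ι M - 1ℚ) + halves M * prodFin n (λ i → 1ℚ + u i)
  log-bound n M u -½≤u = subst₂ _≤_ lhs rhs (+-monoʳ-≤ (ι M - 1ℚ)
    -- M padding factors with u = -½ supply 2⁻ᴹ. As `quad (- ½)` = -1, they lower the sum by M, so
    -- the bound reads 1 + S - M ≤ 2⁻ᴹ ∏ (1 + uᵢ).
    (dominates⇒≤ (dominates-prod n u -½≤u (dominates-prod M (λ _ → - ½) (λ _ → ≤-refl) dominates-empty))))
    where
    S = sumFin n (λ i → quad (u i))
    lhs : (ι M - 1ℚ) + (ι (suc (n ℕ.+ (M ℕ.+ 0))) -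
            ((ι n - S) + ((ι M - sumFin M (λ _ → quad (- ½))) + 0ℚ))) ≡ S
    lhs = trans (cong₂ (λ a b → (ι M - 1ℚ) + ((1ℚ + a) - ((ι n - S) + ((ι M - b) + 0ℚ))))
        (trans (ι-+ n (M ℕ.+ 0)) (cong (ι n +_) (ι-+ M 0))) (sum-const M (quad (- ½))))
      (solve 3 (λ n M S → (M :- con 1ℚ) :+ ((con 1ℚ :+ (n :+ (M :+ con 0ℚ))) :-
                  ((n :- S) :+ ((M :- M :* con (quad (- ½))) :+ con 0ℚ))) := S) refl (ι n) (ι M) S)
    rhs : (ι M - 1ℚ) + prodFin n (λ i → 1ℚ + u i) * (halves M * 1ℚ)
        ≡ (ι M - 1ℚ) + halves M * prodFin n (λ i → 1ℚ + u i)
    rhs = solve 3 (λ M h P → (M :- con 1ℚ) :+ P :* (h :* con 1ℚ) := (M :- con 1ℚ) :+ h :* P)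
      refl (ι M) (halves M) (prodFin n (λ i → 1ℚ + u i))

  -- Products of signed factors averaged over Y.

  -½≤*sign : ∀ {d} b → - ½ ≤ d → d ≤ ½ → - ½ ≤ d * sign b
  -½≤*sign {d} true  -½≤d d≤½ = subst (- ½ ≤_) (sym (*-identityʳ d)) -½≤d
  -½≤*sign {d} false -½≤d d≤½ =
    subst (- ½ ≤_) (solve 1 (λ d → :- d := d :* con (- 1ℚ)) refl d) (neg-antimono-≤ d≤½)

  -½≤*sign*sign : ∀ {d} a b → - ½ ≤ d → d ≤ ½ → - ½ ≤ d * (sign a * sign b)
  -½≤*sign*sign true  true  = -½≤*sign true
  -½≤*sign*sign true  false = -½≤*sign false
  -½≤*sign*sign false true  = -½≤*sign false
  -½≤*sign*sign false false = -½≤*sign true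

  0≤1+ : ∀ {u} → - ½ ≤ u → 0ℚ ≤ 1ℚ + u
  0≤1+ -½≤u = ≤-trans 0≤½ (+-monoʳ-≤ 1ℚ -½≤u)

  -- The common sign b Y may depend on Y, so it is removed by summing over its two values.
  avg-prod-signed≤2 : ∀ n (d : Fin n → ℚ) → (∀ i → - ½ ≤ d i) → (∀ i → d i ≤ ½) →
    (b : (Fin n → Bool) → Bool) →
    avgCube n (λ Y → prodFin n (λ i → 1ℚ + d i * (sign (Y i) * sign (b Y)))) ≤ 1ℚ + 1ℚ
  avg-prod-signed≤2 n d -½≤d d≤½ b = ≤-trans (avg-mono n (λ Y → pointwise Y (b Y)))
    (≤-reflexive (trans (avg-+ n _ _) (cong₂ _+_ (avg-prod≡1 n d) (avg-prod≡1 n (λ i → - d i)))))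
    where
    pointwise : ∀ Y c → prodFin n (λ i → 1ℚ + d i * (sign (Y i) * sign c)) ≤
      prodFin n (λ i → 1ℚ + d i * sign (Y i)) + prodFin n (λ i → 1ℚ + - d i * sign (Y i))
    pointwise Y true = ≤-by-diff _
      (prod-nonneg n (λ i → 0≤1+ (-½≤*sign (Y i) (neg-antimono-≤ (d≤½ i)) (neg-antimono-≤ (-½≤d i)))))
      (cong (_+ prodFin n (λ i → 1ℚ + - d i * sign (Y i)))
        (prod-cong n (λ i → cong (λ s → 1ℚ + d i * s) (*-identityʳ (sign (Y i))))))
    pointwise Y false = ≤-by-diff _
      (prod-nonneg n (λ i → 0≤1+ (-½≤*sign (Y i) (-½≤d i) (d≤½ i))))
      (trans (+-comm _ (prodFin n (λ i → 1ℚ + d i * sign (Y i))))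
        (cong (prodFin n (λ i → 1ℚ + d i * sign (Y i)) +_)
          (prod-cong n (λ i → solve 2 (λ d s → con 1ℚ :+ d :* (s :* con (- 1ℚ)) := con 1ℚ :+ (:- d) :* s)
            refl (d i) (sign (Y i))))))

  -- The concave potential and the inequality for one pair.

  -- φ is within 1/6 of the identity on [0,1], and its strict concavity absorbs the second-order terms.
  φ : ℚ → ℚ
  φ v = v - pos 1 / 6 * (v * v)

  φ≤id : ∀ v → φ v ≤ v
  φ≤id v = ≤-by-diff (pos 1 / 6 * (v * v)) (0≤* (nonNegative⁻¹ (pos 1 / 6)) (0≤p² v))
    (solve 1 (λ v → (v :- con (pos 1 / 6) :* (v :* v)) :+ con (pos 1 / 6) :* (v :* v) := v) refl v)

  0≤φ : ∀ {v} → 0ℚ ≤ v → v ≤ 1ℚ → 0ℚ ≤ φ v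
  0≤φ {v} 0≤v v≤1 = subst (0ℚ ≤_)
    (solve 1 (λ v → v :* (con 1ℚ :- v) :+ con (pos 5 / 6) :* (v :* v) := v :- con (pos 1 / 6) :* (v :* v)) refl v)
    (0≤+ (0≤* 0≤v (p≤q⇒0≤q-p v≤1)) (0≤* (nonNegative⁻¹ (pos 5 / 6)) (0≤p² v)))

  -- With u = ± `tilt A B`, 24 · `quad u` is ±(φ A - φ B) - (φ A - φ B)²/12. The constant 24 makes
  -- that last coefficient equal to the 1/12 that the curvature of φ provides.
  tilt : ℚ → ℚ → ℚ
  tilt A B = pos 1 / 24 * (φ A - φ B)

  tilt-≤½ : ∀ {A B} → 0ℚ ≤ A → A ≤ 1ℚ → 0ℚ ≤ B → B ≤ 1ℚ → tilt A B ≤ ½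
  tilt-≤½ {A} {B} 0≤A A≤1 0≤B B≤1 = ≤-trans
    (*-monoˡ (nonNegative⁻¹ (pos 1 / 24))
      (+-mono-≤ (≤-trans (φ≤id A) A≤1) (neg-antimono-≤ (0≤φ 0≤B B≤1))))
    (≤-by-diff (pos 11 / 24) (nonNegative⁻¹ (pos 11 / 24)) refl)

  -½≤tilt : ∀ {A B} → 0ℚ ≤ A → A ≤ 1ℚ → 0ℚ ≤ B → B ≤ 1ℚ → - ½ ≤ tilt A B
  -½≤tilt {A} {B} 0≤A A≤1 0≤B B≤1 = ≤-trans
    (≤-by-diff (pos 11 / 24) (nonNegative⁻¹ (pos 11 / 24)) refl)
    (*-monoˡ (nonNegative⁻¹ (pos 1 / 24))
      (+-mono-≤ (0≤φ 0≤A A≤1) (neg-antimono-≤ (≤-trans (φ≤id B) B≤1))))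

  -- The derivative of φ.
  slope : ℚ → ℚ
  slope m = 1ℚ - pos 1 / 3 * m

  -- Tangent of φ at m; its curvature pays for the quadratic part of quad.
  pair-bound : ∀ a b {A B} m → 0ℚ ≤ A → A ≤ 1ℚ → 0ℚ ≤ B → B ≤ 1ℚ →
    (1ℚ + sign a * sign b) * φ A + (1ℚ - sign a * sign b) * φ B ≤
    ((φ m - slope m * m) * (1ℚ + 1ℚ) + slope m * (A + B)) + pos 24 / 1 * quad (tilt A B * (sign a * sign b))
  pair-bound a b {A} {B} m 0≤A A≤1 0≤B B≤1 = by-sign a b
    where
    S = pos 1 / 6 * (A + B)
    -- The tangent at m overshoots φ A + φ B by ((A - m)² + (B - m)²)/6 = ((A - B)² + (A + B -
    -- 2m)²)/12. Subtracting (φ A - φ B)²/12, where φ A - φ B = (A - B)(1 - S), leaves D, as 1 - (1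
    -- - S)² = S(2 - S).
    D = pos 1 / 12 * (((A - B) * (A - B)) * (S * (1ℚ + 1ℚ - S)) + (A + B - (m + m)) * (A + B - (m + m)))

    0≤D : 0ℚ ≤ D
    0≤D = 0≤* (nonNegative⁻¹ (pos 1 / 12)) (0≤+
      (0≤* (0≤p² (A - B)) (0≤* (0≤* (nonNegative⁻¹ (pos 1 / 6)) (0≤+ 0≤A 0≤B))
        (p≤q⇒0≤q-p (≤-trans (*-monoˡ (nonNegative⁻¹ (pos 1 / 6)) (+-mono-≤ A≤1 B≤1))
          (≤-by-diff (pos 5 / 3) (nonNegative⁻¹ (pos 5 / 3)) refl)))))
      (0≤p² (A + B - (m + m))))

    φ′ : ∀ {k} → Polynomial k → Polynomial k
    φ′ x = x :- con (pos 1 / 6) :* (x :* x)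

    slope′ : ∀ {k} → Polynomial k → Polynomial k
    slope′ x = con 1ℚ :- con (pos 1 / 3) :* x

    quad′ : ∀ {k} → Polynomial k → Polynomial k
    quad′ x = x :- (x :* x :+ x :* x)

    -- The identity uses r² = 1, so r is inserted as a constant 1 or -1 and not as a variable.
    identity : ∀ {k} → ℚ → (A B m : Polynomial k) → Polynomial k × Polynomial k
    identity r A B m =
      ((con 1ℚ :+ con r) :* φ′ A :+ (con 1ℚ :- con r) :* φ′ B)
        :+ con (pos 1 / 12) :* (((A :- B) :* (A :- B)) :* (s :* (con 1ℚ :+ con 1ℚ :- s))
             :+ (A :+ B :- (m :+ m)) :* (A :+ B :- (m :+ m)))
      := ((φ′ m :- slope′ m :* m) :* (con 1ℚ :+ con 1ℚ) :+ slope′ m :* (A :+ B))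
           :+ con (pos 24 / 1) :* quad′ ((con (pos 1 / 24) :* (φ′ A :- φ′ B)) :* con r)
      where s = con (pos 1 / 6) :* (A :+ B)

    aligned : _
    aligned = ≤-by-diff D 0≤D (solve 3 (identity 1ℚ) refl A B m)

    opposed : _
    opposed = ≤-by-diff D 0≤D (solve 3 (identity (- 1ℚ)) refl A B m)

    by-sign : ∀ a b → (1ℚ + sign a * sign b) * φ A + (1ℚ - sign a * sign b) * φ B ≤
      ((φ m - slope m * m) * (1ℚ + 1ℚ) + slope m * (A + B)) + pos 24 / 1 * quad (tilt A B * (sign a * sign b))
    by-sign true  true  = aligned
    by-sign true  false = opposed
    by-sign false true  = opposed
    by-sign false false = aligned

  -- The planted distributions and a single step.

  pairOf-combine : ∀ {n} (i : Fin n) j → pairOf {n} (combine i j) ≡ i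
  pairOf-combine i j = cong proj₁ (remQuot-combine i j)

  isFirst-zero : ∀ {n} (i : Fin n) → isFirst {n} (combine i zero) ≡ true
  isFirst-zero {n} i rewrite cong proj₂ (remQuot-combine {n} {2} i zero) = refl

  isFirst-one : ∀ {n} (i : Fin n) → isFirst {n} (combine i (suc zero)) ≡ false
  isFirst-one {n} i rewrite cong proj₂ (remQuot-combine {n} {2} i (suc zero)) = refl

  mass : (n : ℕ) → .{{NonZero n}} → ℚ
  mass n = _/_ (pos 1) (n ℕ.* 2) {{ℕ.m*n≢0 n 2}}

  mass-nonneg : ∀ n .{{_ : NonZero n}} → 0ℚ ≤ mass n
  mass-nonneg n = nonNegative⁻¹ (mass n) {{normalize-nonNeg 1 (n ℕ.* 2) {{ℕ.m*n≢0 n 2}}}}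

  planted-first : ∀ n .{{_ : NonZero n}} Y w i →
    planted n Y w (combine i zero) ≡ (1ℚ + sign (Y i) * Zval Y w) * mass n
  planted-first n Y w i rewrite isFirst-zero i | pairOf-combine i zero = refl

  planted-second : ∀ n .{{_ : NonZero n}} Y w i →
    planted n Y w (combine i (suc zero)) ≡ (1ℚ - sign (Y i) * Zval Y w) * mass n
  planted-second n Y w i rewrite isFirst-one i | pairOf-combine i (suc zero) = refl

  IsProb : ∀ {k} → (Fin k → ℚ) → Set
  IsProb {k} p = (∀ x → 0ℚ ≤ p x) × sumFin k p ≡ 1ℚ

  mean-shift : ∀ {k} {p : Fin k → ℚ} → IsProb p → ∀ (g h : Fin k → ℚ) c → (∀ x → g x ≤ h x + c) →
    sumFin k (λ x → p x * g x) ≤ sumFin k (λ x → p x * h x) + c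
  mean-shift {k} {p} (0≤p , Σp≡1) g h c g≤h+c = ≤-trans
    (sum-mono k (λ x → *-monoˡ (0≤p x) (g≤h+c x)))
    (≤-reflexive (trans (sum-cong k (λ x → *-distribˡ-+ (p x) (h x) c))
      (trans (sum-+ k (λ x → p x * h x) (λ x → p x * c))
      (cong (sumFin k (λ x → p x * h x) +_)
        (trans (sum-*ʳ k c p) (trans (cong (_* c) Σp≡1) (*-identityˡ c)))))))

  mean-≤1 : ∀ {k} {p : Fin k → ℚ} → IsProb p → ∀ (g : Fin k → ℚ) → (∀ x → g x ≤ 1ℚ) →
    sumFin k (λ x → p x * g x) ≤ 1ℚ
  mean-≤1 {k} {p} (0≤p , Σp≡1) g g≤1 = ≤-trans (sum-mono k (λ x → *-monoˡ (0≤p x) (g≤1 x)))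
    (≤-reflexive (trans (sum-*ʳ k 1ℚ p) (trans (*-identityʳ _) Σp≡1)))

  uniform-isProb : ∀ n .{{_ : NonZero n}} → IsProb (uniform n)
  uniform-isProb n = (λ _ → mass-nonneg n) ,
    trans (sum-const (n ℕ.* 2) (mass n)) (ι*recip (n ℕ.* 2) {{ℕ.m*n≢0 n 2}})

  0≤1+sign : ∀ a b → 0ℚ ≤ 1ℚ + sign a * sign b
  0≤1+sign true  true  = nonNegative⁻¹ (1ℚ + 1ℚ)
  0≤1+sign true  false = ≤-refl
  0≤1+sign false true  = ≤-refl
  0≤1+sign false false = nonNegative⁻¹ (1ℚ + 1ℚ)

  0≤1-sign : ∀ a b → 0ℚ ≤ 1ℚ - sign a * sign b
  0≤1-sign true  true  = ≤-refl
  0≤1-sign true  false = nonNegative⁻¹ (1ℚ + 1ℚ)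
  0≤1-sign false true  = nonNegative⁻¹ (1ℚ + 1ℚ)
  0≤1-sign false false = ≤-refl

  planted-isProb : ∀ n .{{_ : NonZero n}} Y w → IsProb (planted n Y w)
  planted-isProb n Y w = nonneg , total
    where
    nonneg : ∀ x → 0ℚ ≤ planted n Y w x
    nonneg x with isFirst {n} x
    ... | true  = 0≤* (0≤1+sign (Y (pairOf {n} x)) (inSet1 Y w)) (mass-nonneg n)
    ... | false = 0≤* (0≤1-sign (Y (pairOf {n} x)) (inSet1 Y w)) (mass-nonneg n)

    total : sumFin (n ℕ.* 2) (planted n Y w) ≡ 1ℚ
    total = trans (sum-pairs n (planted n Y w)) (trans
      (sum-cong n (λ i → trans (cong₂ _+_ (planted-first n Y w i) (planted-second n Y w i))
        (solve 2 (λ s υ → (con 1ℚ :+ s) :* υ :+ (con 1ℚ :- s) :* υ := υ :+ υ)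
          refl (sign (Y i) * Zval Y w) (mass n))))
      (trans (sym (sum-pairs n (uniform n))) (proj₂ (uniform-isProb n))))

  -- All pairs use the tangent to φ at the same point, the uniform mean m of h. Summed with weight
  -- υ, the tangent terms therefore collapse to φ m, and only the `quad` terms remain.
  one-step : ∀ n .{{_ : NonZero n}} Y w (h : Elem n → ℚ) → (∀ x → 0ℚ ≤ h x) → (∀ x → h x ≤ 1ℚ) →
    sumFin (n ℕ.* 2) (λ x → planted n Y w x * φ (h x)) ≤
    φ (sumFin (n ℕ.* 2) (λ x → uniform n x * h x)) +
    (pos 24 / 1 * mass n) * sumFin n (λ i →
      quad (tilt (h (combine i zero)) (h (combine i (suc zero))) * (sign (Y i) * Zval Y w)))
  one-step n Y w h 0≤h h≤1 = ≤-trans (≤-reflexive (sum-pairs n (λ x → planted n Y w x * φ (h x))))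
    (≤-trans (sum-mono n pointwise) (≤-reflexive total))
    where
    υ = mass n
    H = λ (x : Elem n) → uniform n x * h x
    m = sumFin (n ℕ.* 2) H
    A = λ (i : Fin n) → h (combine i zero)
    B = λ (i : Fin n) → h (combine i (suc zero))
    q = λ (i : Fin n) → quad (tilt (A i) (B i) * (sign (Y i) * Zval Y w))
    K = φ m - slope m * m
    c = pos 24 / 1 * υ

    pointwise : ∀ i → planted n Y w (combine i zero) * φ (A i) + planted n Y w (combine i (suc zero)) * φ (B i)
      ≤ (K * (υ + υ) + slope m * (υ * A i + υ * B i)) + c * q i
    pointwise i = subst₂ _≤_ lhs rhs (*-monoˡ (mass-nonneg n)
      (pair-bound (Y i) (inSet1 Y w) m (0≤h _) (h≤1 _) (0≤h _) (h≤1 _)))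
      where
      r′ = sign (Y i) * Zval Y w
      lhs : υ * ((1ℚ + r′) * φ (A i) + (1ℚ - r′) * φ (B i)) ≡ _
      lhs = trans
        (solve 4 (λ υ r a b → υ :* ((con 1ℚ :+ r) :* a :+ (con 1ℚ :- r) :* b)
                           := ((con 1ℚ :+ r) :* υ) :* a :+ ((con 1ℚ :- r) :* υ) :* b)
          refl υ r′ (φ (A i)) (φ (B i)))
        (sym (cong₂ (λ x y → x * φ (A i) + y * φ (B i)) (planted-first n Y w i) (planted-second n Y w i)))
      rhs : υ * ((K * (1ℚ + 1ℚ) + slope m * (A i + B i)) + pos 24 / 1 * q i)
          ≡ (K * (υ + υ) + slope m * (υ * A i + υ * B i)) + c * q i
      rhs = solve 6 (λ υ k l a b q →
          υ :* ((k :* (con 1ℚ :+ con 1ℚ) :+ l :* (a :+ b)) :+ con (pos 24 / 1) :* q)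
          := (k :* (υ :+ υ) :+ l :* (υ :* a :+ υ :* b)) :+ (con (pos 24 / 1) :* υ) :* q)
        refl υ K (slope m) (A i) (B i) (q i)

    total : sumFin n (λ i → (K * (υ + υ) + slope m * (υ * A i + υ * B i)) + c * q i) ≡ φ m + c * sumFin n q
    total = trans (sum-+ n _ (λ i → c * q i)) (cong₂ _+_
      (trans (sum-+ n (λ _ → K * (υ + υ)) _) (trans (cong₂ _+_
        (trans (sum-*ˡ n K (λ _ → υ + υ))
          (trans (cong (K *_) (trans (sym (sum-pairs n (uniform n))) (proj₂ (uniform-isProb n)))) (*-identityʳ K)))
        (trans (sum-*ˡ n (slope m) (λ i → υ * A i + υ * B i)) (cong (slope m *_) (sym (sum-pairs n H)))))
        (solve 2 (λ f x → (f :- x) :+ x := f) refl (φ m) (slope m * m))))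
      (sum-*ˡ n c q))

  -- Acceptance probabilities and the hybrid argument.

  accept-bounds : ∀ {n M} (A : Alg n M) (E : Env n) → (∀ w → IsProb (E w)) →
    ∀ k t s → 0ℚ ≤ accept A E k t s × accept A E k t s ≤ 1ℚ
  accept-bounds A E prob zero t s with output A s
  ... | true  = 0≤1 , ≤-refl
  ... | false = ≤-refl , 0≤1
  accept-bounds {n} A E prob (suc k) t s =
    sum-nonneg (n ℕ.* 2) (λ x → 0≤* (proj₁ (prob w) x) (proj₁ (IH x))) ,
    mean-≤1 (prob w) _ (λ x → proj₂ (IH x))
    where
    w = query A t s
    IH = λ x → accept-bounds A E prob k (suc t) (update A t s x)

  -- Mean of h over the state after t steps. It peels off the last step, whereas `accept` peels off
  -- the first, so the two meet at any intermediate time.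
  expect : ∀ {n M} → Alg n M → Env n → ℕ → (Fin (2 ^ M) → ℚ) → ℚ
  expect A E zero    h = h (init A)
  expect {n} A E (suc t) h =
    expect A E t (λ s → sumFin (n ℕ.* 2) (λ x → E (query A t s) x * h (update A t s x)))

  expect-shift : ∀ {n M} (A : Alg n M) (E : Env n) → (∀ w → IsProb (E w)) →
    ∀ t (g h : Fin (2 ^ M) → ℚ) c → (∀ s → g s ≤ h s + c) → expect A E t g ≤ expect A E t h + c
  expect-shift A E prob zero    g h c g≤h+c = g≤h+c (init A)
  expect-shift A E prob (suc t) g h c g≤h+c =
    expect-shift A E prob t _ _ c (λ s → mean-shift (prob (query A t s)) _ _ c (λ x → g≤h+c (update A t s x)))

  module Advantage {n M} .{{_ : NonZero n}} (A : Alg n M) where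

    value : ℕ → ℕ → Fin (2 ^ M) → ℚ
    value = accept A (env0 n)

    0≤value : ∀ k t s → 0ℚ ≤ value k t s
    0≤value k t s = proj₁ (accept-bounds A (env0 n) (λ _ → uniform-isProb n) k t s)

    value≤1 : ∀ k t s → value k t s ≤ 1ℚ
    value≤1 k t s = proj₂ (accept-bounds A (env0 n) (λ _ → uniform-isProb n) k t s)

    expectY : (Fin n → Bool) → ℕ → (Fin (2 ^ M) → ℚ) → ℚ
    expectY Y = expect A (env1 n Y)

    -- Built from values under uniform samples, hence independent of Y; this allows the average over
    -- Y at a fixed state in `avg-gain`.
    coeff : ℕ → ℕ → Fin (2 ^ M) → Fin n → ℚ
    coeff k t s i = tilt (next zero) (next (suc zero))
      where next = λ j → value k (suc t) (update A t s (combine i j))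

    -½≤coeff : ∀ k t s i → - ½ ≤ coeff k t s i
    -½≤coeff k t s i = -½≤tilt (0≤value k _ _) (value≤1 k _ _) (0≤value k _ _) (value≤1 k _ _)

    coeff≤½ : ∀ k t s i → coeff k t s i ≤ ½
    coeff≤½ k t s i = tilt-≤½ (0≤value k _ _) (value≤1 k _ _) (0≤value k _ _) (value≤1 k _ _)

    corr : ℕ → ℕ → (Fin n → Bool) → Fin (2 ^ M) → Fin n → ℚ
    corr k t Y s i = coeff k t s i * (sign (Y i) * Zval Y (query A t s))

    -½≤corr : ∀ k t Y s i → - ½ ≤ corr k t Y s i
    -½≤corr k t Y s i = -½≤*sign*sign (Y i) (inSet1 Y (query A t s)) (-½≤coeff k t s i) (coeff≤½ k t s i)

    density : ℕ → ℕ → Fin (2 ^ M) → (Fin n → Bool) → ℚ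
    density k t s Y = halves M * prodFin n (λ i → 1ℚ + corr k t Y s i)

    scale : ℚ
    scale = pos 24 / 1 * mass n

    0≤scale : 0ℚ ≤ scale
    0≤scale = 0≤* (nonNegative⁻¹ (pos 24 / 1)) (mass-nonneg n)

    gain : ℕ → ℕ → (Fin n → Bool) → ℚ
    gain k t Y = scale * ((ι M - 1ℚ) + sumFin (2 ^ M) (λ s → density k t s Y))

    -- The uniform mean in `one-step` is by definition `value (suc k) t s`. Replacing the density of
    -- the current state by the sum over all states makes the error independent of the state, so
    -- `expect-shift` can carry it out of the expectation.
    gain-bound : ∀ k t Y → expectY Y (suc t) (λ s → φ (value k (suc t) s)) ≤
      expectY Y t (λ s → φ (value (suc k) t s)) + gain k t Y
    gain-bound k t Y = expect-shift A (env1 n Y) (planted-isProb n Y) t _ _ _ (λ s → ≤-trans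
      (one-step n Y (query A t s) (λ x → value k (suc t) (update A t s x))
        (λ x → 0≤value k _ _) (λ x → value≤1 k _ _))
      (+-monoʳ-≤ (φ (value (suc k) t s)) (*-monoˡ 0≤scale (≤-trans
        (log-bound n M (corr k t Y s) (-½≤corr k t Y s))
        (+-monoʳ-≤ (ι M - 1ℚ) (term≤sum (2 ^ M)
          (λ s → 0≤* (halves-nonneg M) (prod-nonneg n (λ i → 0≤1+ (-½≤corr k t Y s i)))) s))))))

    stepGain : ℚ
    stepGain = scale * (ι M + 1ℚ)

    -- Each of the 2ᴹ states contributes at most 2⁻ᴹ · 2 on average, and (M - 1) + 2 = M + 1.
    avg-gain : ∀ k t → avgCube n (gain k t) ≤ stepGain
    avg-gain k t = ≤-trans
      (≤-reflexive (trans (avg-*ˡ n scale _) (cong (scale *_) (trans (avg-+ n (λ _ → ι M - 1ℚ) _)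
        (cong₂ _+_ (avg-const n (ι M - 1ℚ)) (avg-sum n (2 ^ M) (density k t)))))))
      (*-monoˡ 0≤scale (≤-trans
        (+-monoʳ-≤ (ι M - 1ℚ) (sum-mono (2 ^ M) (λ s → ≤-trans
          (≤-reflexive (avg-*ˡ n (halves M) _))
          (*-monoˡ (halves-nonneg M) (avg-prod-signed≤2 n (coeff k t s) (-½≤coeff k t s) (coeff≤½ k t s)
            (λ Y → inSet1 Y (query A t s)))))))
        (≤-reflexive (trans (cong ((ι M - 1ℚ) +_)
          (trans (sum-const (2 ^ M) (halves M * (1ℚ + 1ℚ)))
          (trans (sym (*-assoc (ι (2 ^ M)) (halves M) (1ℚ + 1ℚ))) (cong (_* (1ℚ + 1ℚ)) (ι2^*halves M)))))
          (solve 1 (λ m → (m :- con 1ℚ) :+ con 1ℚ :* (con 1ℚ :+ con 1ℚ) := m :+ con 1ℚ) refl (ι M))))))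

    -- At the end the value is 0 or 1, with φ 0 = 0 and φ 1 = 5/6. This loss is paid once, not per
    -- step.
    output≤φ : ∀ t s → value zero t s ≤ φ (value zero t s) + pos 1 / 6
    output≤φ t s with output A s
    ... | true  = ≤-refl
    ... | false = nonNegative⁻¹ (pos 1 / 6)

    -- After t planted steps, the k remaining ones are turned from planted to uniform, the last one
    -- first, at a cost of `stepGain` each.
    hybrid : ∀ k t → avgCube n (λ Y → expectY Y t (accept A (env1 n Y) k t)) ≤
      avgCube n (λ Y → expectY Y t (λ s → φ (value k t s))) + (pos 1 / 6 + ι k * stepGain)
    hybrid zero t = ≤-trans
      (avg-mono n (λ Y → expect-shift A (env1 n Y) (planted-isProb n Y) t _ _ _ (output≤φ t)))
      (≤-reflexive (trans (avg-+ n _ (λ _ → pos 1 / 6))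
        (cong (avgCube n (λ Y → expectY Y t (λ s → φ (value zero t s))) +_)
        (trans (avg-const n (pos 1 / 6))
          (solve 1 (λ e → con (pos 1 / 6) := con (pos 1 / 6) :+ con 0ℚ :* e) refl stepGain)))))
    -- Running t + 1 planted steps and then accepting from there unfolds to the same expression as
    -- running t and accepting from time t, so the induction hypothesis applies directly.
    hybrid (suc k) t = ≤-trans (hybrid k (suc t)) (≤-trans
      (+-monoˡ-≤ (pos 1 / 6 + ι k * stepGain) (≤-trans (avg-mono n (gain-bound k t))
        (≤-trans (≤-reflexive (avg-+ n _ (gain k t))) (+-monoʳ-≤ G (avg-gain k t)))))
      (≤-reflexive (solve 3 (λ g e k → (g :+ e) :+ (con (pos 1 / 6) :+ k :* e)
          := g :+ (con (pos 1 / 6) :+ (con 1ℚ :+ k) :* e)) refl G stepGain (ι k))))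
      where G = avgCube n (λ Y → expectY Y t (λ s → φ (value (suc k) t s)))

    advantage-bound : ∀ T → avgCube n (λ Y → acceptProb A (env1 n Y) T) ≤
      acceptProb A (env0 n) T + (pos 1 / 6 + ι T * stepGain)
    advantage-bound T = ≤-trans (hybrid T 0) (+-monoˡ-≤ (pos 1 / 6 + ι T * stepGain)
      -- At time 0 the state is `init A` and the value is the uniform one, so nothing depends on Y.
      (≤-trans (≤-reflexive (avg-const n _)) (φ≤id (acceptProb A (env0 n) T))))

    error-bound : ∀ T → ½ - ½ * (pos 1 / 6 + ι T * stepGain) ≤ errorProb n A T
    error-bound T = ≤-by-diff (½ * ((P₀ + δ) - P₁)) (0≤* 0≤½ (p≤q⇒0≤q-p (advantage-bound T)))
      (solve 3 (λ p q d → (con ½ :- con ½ :* d) :+ con ½ :* ((p :+ d) :- q)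
                       := con ½ :* p :+ con ½ :* (con 1ℚ :- q)) refl P₀ P₁ δ)
      where
      P₀ = acceptProb A (env0 n) T
      P₁ = avgCube n (λ Y → acceptProb A (env1 n Y) T)
      δ = pos 1 / 6 + ι T * stepGain

  -- Zero memory, mixtures and the final count.

  accept-stateless : ∀ {n} (A : Alg n 0) (E : Env n) → (∀ w → IsProb (E w)) →
    ∀ k t s → accept A E k t s ≡ accept A E 0 0 zero
  accept-stateless A E prob zero    t zero = refl
  accept-stateless {n} A E prob (suc k) t s = trans
    (sum-cong (n ℕ.* 2) (λ x → cong (E (query A t s) x *_) (accept-stateless A E prob k (suc t) (update A t s x))))
    (trans (sum-*ʳ (n ℕ.* 2) (accept A E 0 0 zero) (E (query A t s)))
    (trans (cong (_* accept A E 0 0 zero) (proj₂ (prob (query A t s)))) (*-identityˡ (accept A E 0 0 zero))))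

  -- For M = 0 the target n ≤ c · (T · M) is false, so this case must be contradictory. The single
  -- state fixes the output, hence the error is ½ > 1/3.
  error-stateless : ∀ n .{{_ : NonZero n}} (A : Alg n 0) T → errorProb n A T ≡ ½
  error-stateless n A T = trans
    (cong₂ (λ p q → ½ * p + ½ * (1ℚ - q)) (accept-stateless A (env0 n) (λ _ → uniform-isProb n) T 0 (init A))
      (trans (avg-cong n (λ Y → accept-stateless A (env1 n Y) (planted-isProb n Y) T 0 (init A)))
        (avg-const n a)))
    (solve 1 (λ a → con ½ :* a :+ con ½ :* (con 1ℚ :- a) := con ½) refl a)
    where a = if output A zero then 1ℚ else 0ℚ

  mixture-bound : ∀ n .{{_ : NonZero n}} {M} T b (R : RandAlg n M) → IsMixture R →
    (∀ A → b ≤ errorProb n A T) → b ≤ randErrorProb n R T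
  mixture-bound n T b R (0≤weight , Σweight≡1) b≤err = subst (_≤ randErrorProb n R T)
    (trans (sum-*ʳ (r R) b (weight R)) (trans (cong (_* b) Σweight≡1) (*-identityˡ b)))
    (sum-mono (r R) (λ k → *-monoˡ (0≤weight k) (b≤err (alg R k))))

  space-time-bound : ∀ n .{{_ : NonZero n}} M T →
    ½ - ½ * (pos 1 / 6 + ι T * ((pos 24 / 1 * mass n) * (ι M + 1ℚ))) ≤ pos 1 / 3 →
    n ℕ.≤ 72 ℕ.* (T ℕ.* suc M)
  space-time-bound n M T h = ι-cancel-≤ n (72 ℕ.* (T ℕ.* suc M))
    -- The hypothesis amounts to 1/12 ≤ 12 T (M + 1) / 2n; it is multiplied by 12n, written as 6 ·
    -- (2n) so that 2n cancels against `mass n`.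
    (≤-by-diff _ (0≤* (0≤* (nonNegative⁻¹ (pos 6 / 1)) (0≤ι (n ℕ.* 2))) (p≤q⇒0≤q-p h)) eq)
    where
    X = ι T * (ι M + 1ℚ)
    eq : ι n + (pos 6 / 1 * ι (n ℕ.* 2)) *
           (pos 1 / 3 - (½ - ½ * (pos 1 / 6 + ι T * ((pos 24 / 1 * mass n) * (ι M + 1ℚ)))))
       ≡ ι (72 ℕ.* (T ℕ.* suc M))
    eq = trans (solve 5 (λ n n2 υ t m →
          n :+ (con (pos 6 / 1) :* n2) :* (con (pos 1 / 3) :-
            (con ½ :- con ½ :* (con (pos 1 / 6) :+ t :* ((con (pos 24 / 1) :* υ) :* (m :+ con 1ℚ)))))
          := (n :- con ½ :* n2) :+ con (pos 72 / 1) :* (t :* (con 1ℚ :+ m)) :* (n2 :* υ))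
        refl (ι n) (ι (n ℕ.* 2)) (mass n) (ι T) (ι M))
      (trans (cong₂ (λ a b → (ι n - ½ * a) + pos 72 / 1 * (ι T * (1ℚ + ι M)) * b)
          (ι-* n 2) (ι*recip (n ℕ.* 2) {{ℕ.m*n≢0 n 2}}))
      (trans (solve 2 (λ n x → (n :- con ½ :* (n :* con (ι 2))) :+ con (pos 72 / 1) :* x :* con 1ℚ := con (ι 72) :* x)
          refl (ι n) (ι T * (1ℚ + ι M)))
      (sym (trans (ι-* 72 (T ℕ.* suc M)) (cong (ι 72 *_) (ι-* T (suc M)))))))

  space-time-tradeoff : ∀ n .{{_ : NonZero n}} M T (R : RandAlg n M) → IsMixture R →
    randErrorProb n R T ≤ pos 1 / 3 → n ℕ.≤ 144 ℕ.* (T ℕ.* M)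
  space-time-tradeoff n zero T R mix err = ⊥-elim (from-no (½ ≤? pos 1 / 3)
    (≤-trans (mixture-bound n T ½ R mix (λ A → ≤-reflexive (sym (error-stateless n A T)))) err))
  space-time-tradeoff n M@(suc m) T R mix err = ℕ.≤-trans
    (space-time-bound n M T (≤-trans (mixture-bound n T _ R mix (λ A → Advantage.error-bound A T)) err))
    -- As M ≥ 1, M + 1 ≤ 2M, which doubles 72 to 144.
    (ℕ.≤-trans (ℕ.*-monoʳ-≤ 72 (ℕ.*-monoʳ-≤ T (ℕ.+-monoʳ-≤ 1 (ℕ.m≤n+m M m))))
      (ℕ.≤-reflexive (ℕ-Solver.solve 2 (λ t m →
          ℕ-Solver.con 72 ℕ-Solver.:* (t ℕ-Solver.:* (m ℕ-Solver.:+ m))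
            ℕ-Solver.:= ℕ-Solver.con 144 ℕ-Solver.:* (t ℕ-Solver.:* m)) refl T M)))

open import Data.Nat using (ℕ; NonZero; _≤_; _*_)
open import Data.Product using (Σ)
open import Data.Integer using (+_)
open import Data.Rational using (_/_)
open import Data.Rational as Q using ()

theorem8 : Σ ℕ λ c → Σ ℕ λ n₀ → (n : ℕ) → .{{_ : NonZero n}} → n₀ ≤ n →
    (M T : ℕ) (𝒜 : RandAlg n M) → IsMixture 𝒜 →
    randErrorProb n 𝒜 T Q.≤ (+ 1 / 3) →
    n ≤ c * (T * M)
theorem8 = 144 , 0 , λ n _ M T → Lemmas.space-time-tradeoff n M T
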